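{- Let $\mathbb S=(A,\prec)$ be a subordination lattice, with subordination space $\mathbb S_*=((J^\infty(A^\delta),\sqsubseteq),R)$, where $R=R_\prec$. With $i,j,k,i',j',k'$ ranging over $J^\infty(A^\delta)$: (i) $\mathbb S$ satisfies (CT) iff $\forall i\forall j\,(jRi\Rightarrow\exists k(j\sqsubseteq k\ \&\ jRk\ \&\ kRi))$; (ii) $\mathbb S$ satisfies (S9) iff $\forall i\forall j\forall k\,\big((kRi\ \&\ kRj)\Leftrightarrow\exists k'(k'\sqsubseteq i\ \&\ k'Rj\ \&\ kRk')\big)$; (iii) $\mathbb S$ satisfies (SL1) iff $\forall i\forall j\forall k\forall i'\,(i'Ri\ \&\ i'Rj\ \&\ kRi'\Rightarrow\exists j'(j'\sqsubseteq i\ \&\ j'\sqsubseteq j\ \&\ kRj'))$; (iv) $\mathbb S$ satisfies (SL2) iff $\forall i\forall j\forall k\forall i'\,(i'Rk\ \&\ iRi'\ \&\ jRi'\Rightarrow\exists j'(j'Rk\ \&\ i\sqsubseteq j'\ \&\ j\sqsubseteq j'))$.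
   Context: A subordination lattice is a pair $(A,\prec)$ with $A$ a bounded distributive lattice and $\prec\,\subseteq A\times A$ such that $\bot\prec\bot$; $\top\prec\top$; $a\le b\prec x\Rightarrow a\prec x$; $b\prec x\le y\Rightarrow b\prec y$; $a\prec x\ \&\ a\prec y\Rightarrow a\prec x\wedge y$; $a\prec x\ \&\ b\prec x\Rightarrow a\vee b\prec x$. $A^\delta$ is the canonical extension of $A$: a complete lattice containing $A$ as a sublattice such that every element is both a join of closed elements (meets of nonempty down-directed subsets of $A$) and a meet of open elements (joins of nonempty up-directed subsets of $A$), and such that $\bigwedge F\le\bigvee I$ with $F\subseteq A$ nonempty down-directed, $I\subseteq A$ nonempty up-directed implies $a\le b$ for some $a\in F$, $b\in I$. $J^\infty(A^\delta)$ is the set of completely join-irreducible elements of $A^\delta$ (equivalently completely join-prime; they correspond to the prime filters $P$ of $A$ via $P\mapsto\bigwedge P$). For $a\in A$, $\Diamond a=\bigwedge\{b\in A\mid a\prec b\}$ and $\blacksquare a=\bigvee\{b\in A\mid b\prec a\}$ in $A^\delta$; for closed $k$, $\Diamond k=\bigwedge\{\Diamond a\mid a\in A,k\le a\}$; for open $o$, $\blacksquare o=\bigvee\{\blacksquare a\mid a\in A,a\le o\}$. The subordination space of $\mathbb S$: $j\sqsubseteq k$ iff $j\ge k$ in $A^\delta$; $R_\prec(j,i)$ iff $i\le\Diamond j$ (equivalently $\blacksquare\kappa(i)\le\kappa(j)$, where $\kappa(i)=\bigvee\{i'\in J^\infty(A^\delta)\mid i\not\le i'\}$). Conditions (free variables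 universally quantified over $A$): (CT) $a\prec b\ \&\ a\wedge b\prec c\Rightarrow a\prec c$. (S9) $\exists c(c\prec b\ \&\ x\prec a\vee c)\Leftrightarrow\exists a'\exists b'(a'\prec a\ \&\ b'\prec b\ \&\ x\le a'\vee b')$. (SL1) $a\prec b\vee c\Rightarrow\exists b'\exists c'(b'\prec b\ \&\ c'\prec c\ \&\ a\prec b'\vee c')$. (SL2) $b\wedge c\prec a\Rightarrow\exists b'\exists c'(b\prec b'\ \&\ c\prec c'\ \&\ b'\wedge c'\prec a)$. -}

module Defs where

open import Level using (Level; suc)
open import Data.Product using (∃; ∃-syntax; Σ-syntax; _×_; _,_; proj₁; proj₂)
open import Data.Sum using (_⊎_)
open import Function.Bundles using (_⇔_)
open import Relation.Binary.Core using (Rel)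
open import Relation.Binary.Bundles using (Poset)
open import Relation.Binary.Lattice using (Lattice; BoundedLattice)
open import Relation.Unary using (Pred; _∈_; _⊆_; Satisfiable)
import Algebra.Definitions as AlgebraDefinitions
import Algebra.Lattice.Bundles as AlgebraicLattice
open import Algebra.Lattice.Bundles using (RawLattice)
open import Algebra.Lattice.Morphism.Structures using (module LatticeMorphisms)
import Relation.Binary.Lattice.Properties.Lattice as LatticeProperties

-- Prime filters of arbitrary distributive lattices are only available in the
-- presence of a choice principle; together with `ExcludedMiddle`, Zorn's lemma
-- stands for the classical set theory in which canonical extensions are
-- usually studied.

ZornsLemma : (ℓ : Level) → Set (suc ℓ)
ZornsLemma ℓ =
  (P : Poset ℓ ℓ ℓ) → let open Poset P in
  ((C : Pred Carrier ℓ) →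
     (∀ {x y} → x ∈ C → y ∈ C → x ≤ y ⊎ y ≤ x) →
     ∃[ u ] (∀ {x} → x ∈ C → x ≤ u)) →
  ∃[ m ] (∀ x → m ≤ x → m ≈ x)

rawLattice : ∀ {ℓ} → Lattice ℓ ℓ ℓ → RawLattice ℓ ℓ
rawLattice L = AlgebraicLattice.Lattice.rawLattice (LatticeProperties.algLattice L)

record SubordinationLattice (ℓ : Level) : Set (suc ℓ) where
  infix 4 _≺_
  field
    boundedLattice : BoundedLattice ℓ ℓ ℓ

  open BoundedLattice boundedLattice public
  open AlgebraDefinitions _≈_ using (_DistributesOverˡ_)

  field
    ∧-distribˡ-∨ : _∧_ DistributesOverˡ _∨_
    _≺_          : Rel Carrier ℓ
    ⊥≺⊥          : ⊥ ≺ ⊥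
    ⊤≺⊤          : ⊤ ≺ ⊤
    ≤-≺-trans    : ∀ {a b x} → a ≤ b → b ≺ x → a ≺ x
    ≺-≤-trans    : ∀ {b x y} → b ≺ x → x ≤ y → b ≺ y
    ≺-∧          : ∀ {a x y} → a ≺ x → a ≺ y → a ≺ (x ∧ y)
    ≺-∨          : ∀ {a b x} → a ≺ x → b ≺ x → (a ∨ b) ≺ x

module Conditions {ℓ : Level} (𝕊 : SubordinationLattice ℓ) where
  open SubordinationLattice 𝕊

  CT : Set ℓ
  CT = ∀ a b c → a ≺ b → (a ∧ b) ≺ c → a ≺ c

  S9 : Set ℓ
  S9 = ∀ a b x →
    (∃[ c ] (c ≺ b × x ≺ (a ∨ c)))
      ⇔ (∃[ a′ ] ∃[ b′ ] (a′ ≺ a × b′ ≺ b × x ≤ (a′ ∨ b′)))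

  SL1 : Set ℓ
  SL1 = ∀ a b c → a ≺ (b ∨ c) →
    ∃[ b′ ] ∃[ c′ ] (b′ ≺ b × c′ ≺ c × a ≺ (b′ ∨ c′))

  SL2 : Set ℓ
  SL2 = ∀ a b c → (b ∧ c) ≺ a →
    ∃[ b′ ] ∃[ c′ ] (b ≺ b′ × c ≺ c′ × (b′ ∧ c′) ≺ a)

record CompleteLattice (ℓ : Level) : Set (suc ℓ) where
  field
    lattice : Lattice ℓ ℓ ℓ

  open Lattice lattice public

  field
    ⋁        : Pred Carrier ℓ → Carrier
    ⋁-upper  : ∀ S {x} → x ∈ S → x ≤ ⋁ S
    ⋁-least  : ∀ S {y} → (∀ {x} → x ∈ S → x ≤ y) → ⋁ S ≤ y
    ⋀        : Pred Carrier ℓ → Carrier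
    ⋀-lower  : ∀ S {x} → x ∈ S → ⋀ S ≤ x
    ⋀-greatest : ∀ S {y} → (∀ {x} → x ∈ S → y ≤ x) → y ≤ ⋀ S

module _ {ℓ : Level} (A : Lattice ℓ ℓ ℓ) where
  open Lattice A

  DownDirected : Pred Carrier ℓ → Set ℓ
  DownDirected F =
    Satisfiable F ×
    (∀ {a b} → a ∈ F → b ∈ F → ∃[ c ] (c ∈ F × c ≤ a × c ≤ b))

  UpDirected : Pred Carrier ℓ → Set ℓ
  UpDirected I =
    Satisfiable I ×
    (∀ {a b} → a ∈ I → b ∈ I → ∃[ c ] (c ∈ I × a ≤ c × b ≤ c))

module Embedded {ℓ : Level} (A : Lattice ℓ ℓ ℓ) (L : CompleteLattice ℓ)
                (ι : Lattice.Carrier A → CompleteLattice.Carrier L) where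
  private
    module A = Lattice A
  open CompleteLattice L

  Image : Pred A.Carrier ℓ → Pred Carrier ℓ
  Image S x = ∃[ a ] (a ∈ S × x ≈ ι a)

  Closed : Pred Carrier (suc ℓ)
  Closed x = ∃[ F ] (DownDirected A F × x ≈ ⋀ (Image F))

  Open : Pred Carrier (suc ℓ)
  Open x = ∃[ I ] (UpDirected A I × x ≈ ⋁ (Image I))

-- Preservation of the bounds is not a field: it follows from density, because
-- the directed sets defining closed and open elements are nonempty.

record CanonicalExtension {ℓ : Level} (A : Lattice ℓ ℓ ℓ) : Set (suc ℓ) where
  private
    module A = Lattice A
  field
    completeLattice : CompleteLattice ℓ

  open CompleteLattice completeLattice public

  field
    ι : A.Carrier → Carrier

  open Embedded A completeLattice ι public
  open LatticeMorphisms (rawLattice A) (rawLattice lattice)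
    using (IsLatticeMonomorphism)

  field
    ι-isLatticeMonomorphism : IsLatticeMonomorphism ι
    join-of-closed : ∀ u → Σ[ S ∈ Pred Carrier ℓ ] (S ⊆ Closed × u ≈ ⋁ S)
    meet-of-open   : ∀ u → Σ[ S ∈ Pred Carrier ℓ ] (S ⊆ Open × u ≈ ⋀ S)
    compact        : ∀ F I → DownDirected A F → UpDirected A I →
                     ⋀ (Image F) ≤ ⋁ (Image I) →
                     ∃[ a ] ∃[ b ] (a ∈ F × b ∈ I × a A.≤ b)

  -- Taking S empty shows that such a j is not the least element.
  CompletelyJoinIrreducible : Pred Carrier (suc ℓ)
  CompletelyJoinIrreducible j =
    (S : Pred Carrier ℓ) → j ≈ ⋁ S → ∃[ x ] (x ∈ S × j ≈ x)

  J∞ : Set (suc ℓ)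
  J∞ = ∃ CompletelyJoinIrreducible

  J∞⇒Closed : ∀ {j} → CompletelyJoinIrreducible j → Closed j
  J∞⇒Closed {j} irr with join-of-closed j
  ... | S , S⊆Closed , j≈⋁S with irr S j≈⋁S
  ...   | x , x∈S , j≈x with S⊆Closed x∈S
  ...     | F , F-directed , x≈⋀F = F , F-directed , Eq.trans j≈x x≈⋀F

module SubordinationSpace
  {ℓ : Level} (𝕊 : SubordinationLattice ℓ)
  (Aδ : CanonicalExtension
          (BoundedLattice.lattice (SubordinationLattice.boundedLattice 𝕊)))
  where
  private
    module A = SubordinationLattice 𝕊
  open CanonicalExtension Aδ public using (J∞)
  open CanonicalExtension Aδ hiding (J∞)
  open A using (_≺_)

  infix 4 _⊑_

  ◇ᴬ : A.Carrier → Carrier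
  ◇ᴬ a = ⋀ (Image (λ b → a ≺ b))

  ◇ : ∃ Closed → Carrier
  ◇ (k , _) = ⋀ (λ x → ∃[ a ] (k ≤ ι a × x ≈ ◇ᴬ a))

  _⊑_ : J∞ → J∞ → Set ℓ
  j ⊑ k = proj₁ k ≤ proj₁ j

  R : J∞ → J∞ → Set ℓ
  R j i = proj₁ i ≤ ◇ (proj₁ j , J∞⇒Closed (proj₂ j))

{-# OPTIONS --safe #-}

-- Via j ↦ P j = {a ∣ j ≤ ι a}, completely join-irreducible elements behave as
-- prime filters: j ⊑ k means P j ⊆ P k, and R j i means that a ∈ P j and a ≺ b
-- imply b ∈ P i.  In each equivalence both directions come from separating a
-- filter from an ideal by a prime filter.  Separation is Zorn's lemma applied
-- inside Aδ: among the closed elements below ⋀ F and not below ⋁ I there is a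
-- minimal one, and density by closed elements makes it completely
-- join-irreducible.

module Submission where

open import Defs
open import Level using (Level; suc)
open import Data.Empty.Polymorphic using () renaming (⊥ to Empty)
open import Data.Product using (∃; ∃-syntax; _×_; _,_; proj₁; proj₂)
open import Data.Sum using (_⊎_; inj₁; inj₂; [_,_]′)
open import Function.Base using (case_of_)
open import Function.Bundles using (_⇔_; mk⇔; module Equivalence)
open import Axiom.ExcludedMiddle using (ExcludedMiddle)
open import Relation.Binary.Bundles using (Poset)
open import Relation.Binary.Lattice using (Lattice; module BoundedLattice)
open import Relation.Nullary using (¬_)
open import Relation.Nullary.Decidable using (decidable-stable)
open import Relation.Unary using (Pred; _∈_; _∉_; _⊆_; ∁)
open import Algebra.Lattice.Morphism.Structures using (module LatticeMorphisms)

-- Closed elements and their filters in the canonical extension.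

module CanonicalExtensionProperties
  {ℓ : Level} (em : ExcludedMiddle ℓ) {A : Lattice ℓ ℓ ℓ} (Aδ : CanonicalExtension A) where
  private
    module A = Lattice A
  open import Relation.Binary.Lattice.Properties.MeetSemilattice A.meetSemilattice
    using (∧-monotonic)
  open CanonicalExtension Aδ
  open LatticeMorphisms (rawLattice A) (rawLattice lattice)
    using (module IsLatticeMonomorphism)
  open IsLatticeMonomorphism ι-isLatticeMonomorphism
    using (∧-homo; ∨-homo) renaming (⟦⟧-cong to ι-cong)

  private
    stable : {X : Set ℓ} → ¬ ¬ X → X
    stable = decidable-stable em

  ι-mono : ∀ {a b} → a A.≤ b → ι a ≤ ι b
  ι-mono {a} {b} a≤b = trans
    (reflexive (Eq.trans (ι-cong (A.antisym (A.∧-greatest A.refl a≤b) (A.x∧y≤x a b)))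
                         (∧-homo a b)))
    (x∧y≤y (ι a) (ι b))

  P : Carrier → Pred A.Carrier ℓ
  P x a = x ≤ ι a

  ⋀-Image-lower : ∀ {F a} → a ∈ F → ⋀ (Image F) ≤ ι a
  ⋀-Image-lower a∈F = ⋀-lower _ (_ , a∈F , Eq.refl)

  ⋀-Image-greatest : ∀ {F x} → F ⊆ P x → x ≤ ⋀ (Image F)
  ⋀-Image-greatest F⊆P = ⋀-greatest _ λ { (a , a∈F , y≈ιa) →
    trans (F⊆P a∈F) (reflexive (Eq.sym y≈ιa)) }

  ⋁-Image-upper : ∀ {I a} → a ∈ I → ι a ≤ ⋁ (Image I)
  ⋁-Image-upper a∈I = ⋁-upper _ (_ , a∈I , Eq.refl)

  P-up : ∀ {x a b} → a A.≤ b → a ∈ P x → b ∈ P x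
  P-up a≤b a∈P = trans a∈P (ι-mono a≤b)

  P-∧ : ∀ {x a b} → a ∈ P x → b ∈ P x → a A.∧ b ∈ P x
  P-∧ {x} {a} {b} a∈P b∈P =
    trans (∧-greatest a∈P b∈P) (reflexive (Eq.sym (∧-homo a b)))

  -- `Closed` lives one universe too high for Zorn's lemma; this does not.
  IsClosed : Pred Carrier ℓ
  IsClosed x = ⋀ (Image (P x)) ≤ x

  Closed⇒IsClosed : ∀ {x} → Closed x → IsClosed x
  Closed⇒IsClosed (F , _ , x≈⋀F) =
    trans (⋀-Image-greatest λ a∈F →
             ⋀-Image-lower (trans (reflexive x≈⋀F) (⋀-Image-lower a∈F)))
          (reflexive (Eq.sym x≈⋀F))

  Closed⇒P-nonempty : ∀ {x} → Closed x → ∃ (P x)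
  Closed⇒P-nonempty (F , ((a , a∈F) , _) , x≈⋀F) =
    a , trans (reflexive x≈⋀F) (⋀-Image-lower a∈F)

  P-directed : ∀ {x} → Closed x → DownDirected A (P x)
  P-directed closed =
    Closed⇒P-nonempty closed ,
    λ {a} {b} a∈P b∈P → a A.∧ b , P-∧ a∈P b∈P , A.x∧y≤x a b , A.x∧y≤y a b

  -- By density `y` is a meet of open elements, so it is enough to bound `x` by the open elements
  -- above `y`.
  ≤-open : ∀ {x y} → (∀ {I} → UpDirected A I → y ≤ ⋁ (Image I) → x ≤ ⋁ (Image I)) → x ≤ y
  ≤-open {x} {y} h with meet-of-open y
  ... | S , S⊆Open , y≈⋀S = trans (⋀-greatest S lower) (reflexive (Eq.sym y≈⋀S))
    where
    lower : ∀ {o} → o ∈ S → x ≤ o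
    lower o∈S with S⊆Open o∈S
    ... | I , dI , o≈⋁I =
      trans (h dI (trans (reflexive y≈⋀S) (trans (⋀-lower S o∈S) (reflexive o≈⋁I))))
            (reflexive (Eq.sym o≈⋁I))

  -- Separating a filter from an ideal.

  module _ (zorn : ZornsLemma ℓ) where

    separation : ∀ {F I} → DownDirected A F → UpDirected A I →
                 (∀ {a b} → a ∈ F → b ∈ I → ¬ a A.≤ b) →
                 ∃[ j ] (F ⊆ P (proj₁ {B = CompletelyJoinIrreducible} j) × I ⊆ ∁ (P (proj₁ j)))
    separation {F} {I} dF dI disjoint =
      (m , irreducible) ,
      (λ a∈F → trans m≤k (⋀-Image-lower a∈F)) ,
      λ b∈I m≤ιb → m≰o (trans m≤ιb (⋁-Image-upper b∈I))
      where
      k o : Carrier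
      k = ⋀ (Image F)
      o = ⋁ (Image I)

      Candidate : Pred Carrier ℓ
      Candidate x = IsClosed x × x ≤ k × ¬ x ≤ o

      k-candidate : Candidate k
      k-candidate = Closed⇒IsClosed (F , dF , Eq.refl) , refl , λ k≤o →
        case compact F I dF dI k≤o of λ { (a , b , a∈F , b∈I , a≤b) → disjoint a∈F b∈I a≤b }

      -- Zorn's lemma gives maximal elements; in the reversed order these are minimal candidates.
      reversed : Poset ℓ ℓ ℓ
      reversed = record
        { Carrier = ∃ Candidate
        ; _≈_ = λ x y → proj₁ x ≈ proj₁ y
        ; _≤_ = λ x y → proj₁ y ≤ proj₁ x
        ; isPartialOrder = record
          { isPreorder = record
            { isEquivalence = record
              { refl = Eq.refl ; sym = Eq.sym ; trans = Eq.trans }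
            ; reflexive = λ x≈y → reflexive (Eq.sym x≈y)
            ; trans = λ y≤x z≤y → trans z≤y y≤x
            }
          ; antisym = λ y≤x x≤y → antisym x≤y y≤x
          }
        }

      chain-bounded : (C : Pred (∃ Candidate) ℓ) →
        (∀ {x y} → x ∈ C → y ∈ C → proj₁ y ≤ proj₁ x ⊎ proj₁ x ≤ proj₁ y) →
        ∃[ u ] (∀ {x} → x ∈ C → proj₁ {B = Candidate} u ≤ proj₁ x)
      chain-bounded C total =
        -- The meet of the union `G` of the filters serves as bound: it is closed by construction
        -- and amenable to compactness.
        (⋀ (Image G) , Closed⇒IsClosed (G , dG , Eq.refl) , ⋀G≤k , ⋀G≰o) ,
        λ {x} x∈C → trans (⋀-Image-greatest λ a∈P → ⋀-Image-lower (inj₂ (x , x∈C , a∈P)))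
                          (proj₁ (proj₂ x))
        where
        -- The first summand provides for the empty chain.
        G : Pred A.Carrier ℓ
        G a = a ∈ P k ⊎ (∃[ x ] (x ∈ C × a ∈ P (proj₁ x)))

        ⋀G≤k : ⋀ (Image G) ≤ k
        ⋀G≤k = trans (⋀-Image-greatest λ a∈P → ⋀-Image-lower (inj₁ a∈P)) (proj₁ k-candidate)

        meet : ∀ {a b} → a A.∧ b ∈ G → ∃[ c ] (c ∈ G × c A.≤ a × c A.≤ b)
        meet {a} {b} ab∈G = a A.∧ b , ab∈G , A.x∧y≤x a b , A.x∧y≤y a b

        directed : ∀ {a b} → a ∈ G → b ∈ G → a A.∧ b ∈ G
        directed (inj₁ p) (inj₁ q) = inj₁ (P-∧ p q)
        directed (inj₁ p) (inj₂ (x , x∈C , q)) =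
          inj₂ (x , x∈C , P-∧ (trans (proj₁ (proj₂ (proj₂ x))) p) q)
        directed (inj₂ (x , x∈C , p)) (inj₁ q) =
          inj₂ (x , x∈C , P-∧ p (trans (proj₁ (proj₂ (proj₂ x))) q))
        -- The smaller of the two chain elements has the larger filter, which holds both `a` and
        -- `b`.
        directed (inj₂ (x , x∈C , p)) (inj₂ (y , y∈C , q)) with total x∈C y∈C
        ... | inj₁ y≤x = inj₂ (y , y∈C , P-∧ (trans y≤x p) q)
        ... | inj₂ x≤y = inj₂ (x , x∈C , P-∧ p (trans x≤y q))

        dG : DownDirected A G
        dG = (let a , a∈P = Closed⇒P-nonempty (F , dF , Eq.refl) in a , inj₁ a∈P) ,
             λ a∈G b∈G → meet (directed a∈G b∈G)

        -- Compactness leaves a single `a ∈ G` below some `b ∈ I`, which would push `k` or one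
        -- member of the chain below `o`.
        ⋀G≰o : ¬ ⋀ (Image G) ≤ o
        ⋀G≰o ⋀G≤o with compact G I dG dI ⋀G≤o
        ... | a , b , inj₁ a∈P , b∈I , a≤b =
          proj₂ (proj₂ k-candidate) (trans (P-up a≤b a∈P) (⋁-Image-upper b∈I))
        ... | a , b , inj₂ ((x , _ , _ , x≰o) , _ , a∈P) , b∈I , a≤b =
          x≰o (trans (P-up a≤b a∈P) (⋁-Image-upper b∈I))

      maximal : ∃[ m ] (∀ x → proj₁ x ≤ proj₁ m → proj₁ {B = Candidate} m ≈ proj₁ {B = Candidate} x)
      maximal = zorn reversed chain-bounded

      m : Carrier
      m = proj₁ (proj₁ maximal)

      m≤k : m ≤ k
      m≤k = proj₁ (proj₂ (proj₂ (proj₁ maximal)))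

      m≰o : ¬ m ≤ o
      m≰o = proj₂ (proj₂ (proj₂ (proj₁ maximal)))

      not-below : ∀ (S : Pred Carrier ℓ) {x} → x ≈ ⋁ S → ¬ x ≤ o → ∃[ y ] (y ∈ S × ¬ y ≤ o)
      not-below S x≈⋁S x≰o = stable λ none →
        x≰o (trans (reflexive x≈⋁S) (⋁-least S λ y∈S → stable λ y≰o → none (_ , y∈S , y≰o)))

      -- Some `x ∈ S` escapes `o`, and so does some closed `t ≤ x`. This `t` is a candidate, so
      -- minimality forces `m ≈ t ≤ x ≤ m`.
      irreducible : CompletelyJoinIrreducible m
      irreducible S m≈⋁S with not-below S m≈⋁S m≰o
      ... | x , x∈S , x≰o with join-of-closed x
      ... | T , T⊆Closed , x≈⋁T with not-below T x≈⋁T x≰o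
      ... | t , t∈T , t≰o = x , x∈S , antisym (trans (reflexive m≈t) t≤x) x≤m
        where
        x≤m : x ≤ m
        x≤m = trans (⋁-upper S x∈S) (reflexive (Eq.sym m≈⋁S))

        t≤x : t ≤ x
        t≤x = trans (⋁-upper T t∈T) (reflexive (Eq.sym x≈⋁T))

        t≤m : t ≤ m
        t≤m = trans t≤x x≤m

        m≈t : m ≈ t
        m≈t = proj₂ maximal
          (t , Closed⇒IsClosed (T⊆Closed t∈T) , trans t≤m m≤k , t≰o) t≤m

  -- Primeness of the filters of completely join-irreducible elements.

  module _ {j : Carrier} (irr : CompletelyJoinIrreducible j) where

    -- ι ⊥ lies below every open element, hence below ⋁ ∅.
    irreducible-⊥ : ∀ {a} → (∀ b → a A.≤ b) → a ∉ P j
    irreducible-⊥ a≤ j≤ιa with irr (λ _ → Empty) j≈⋁∅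
      where
      j≈⋁∅ : j ≈ ⋁ (λ _ → Empty)
      j≈⋁∅ = antisym
        (≤-open λ { ((b , b∈I) , _) _ → trans j≤ιa (trans (ι-mono (a≤ b)) (⋁-Image-upper b∈I)) })
        (⋁-least _ λ ())
    ... | _ , () , _

    -- j ∧ (ι a ∨ ι b) ≤ (j ∧ ι a) ∨ (j ∧ ι b) is checked against open elements,
    -- where compactness reduces it to distributivity in A.
    irreducible-∨ :
      (∀ x y z → x A.∧ (y A.∨ z) A.≤ (x A.∧ y) A.∨ (x A.∧ z)) →
      ∀ {a b} → a A.∨ b ∈ P j → a ∈ P j ⊎ b ∈ P j
    irreducible-∨ distrib {a} {b} j≤ιa∨b with irr S j≈⋁S
      where
      S : Pred Carrier ℓ
      S x = x ≈ j ∧ ι a ⊎ x ≈ j ∧ ι b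

      closed : Closed j
      closed = J∞⇒Closed irr

      -- The meet of the directed family `f ∧ c` with `f ∈ P j` lies below `j ∧ ι c`, so compactness
      -- finds one `f ∧ c` under a member of `I`.
      below-open : ∀ {c I} → UpDirected A I → j ∧ ι c ≤ ⋁ (Image I) →
                   ∃[ f ] ∃[ d ] (f ∈ P j × d ∈ I × f A.∧ c A.≤ d)
      below-open {c} {I} dI j∧ιc≤o
        with compact F I dF dI (trans (∧-greatest ⋀F≤j ⋀F≤ιc) j∧ιc≤o)
        where
        F : Pred A.Carrier ℓ
        F x = ∃[ f ] (f ∈ P j × f A.∧ c A.≤ x)

        dF : DownDirected A F
        dF = (let f , f∈P = Closed⇒P-nonempty closed in f A.∧ c , f , f∈P , A.refl) ,
          λ { {x} {y} (f , f∈P , fc≤x) (g , g∈P , gc≤y) →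
            (f A.∧ g) A.∧ c , (f A.∧ g , P-∧ f∈P g∈P , A.refl) ,
            A.trans (∧-monotonic (A.x∧y≤x f g) A.refl) fc≤x ,
            A.trans (∧-monotonic (A.x∧y≤y f g) A.refl) gc≤y }

        ⋀F≤j : ⋀ (Image F) ≤ j
        ⋀F≤j = trans
          (⋀-Image-greatest λ {f} f∈P → ⋀-Image-lower (f , f∈P , A.x∧y≤x f c))
          (Closed⇒IsClosed closed)

        ⋀F≤ιc : ⋀ (Image F) ≤ ι c
        ⋀F≤ιc =
          let f , f∈P = Closed⇒P-nonempty closed in ⋀-Image-lower (f , f∈P , A.x∧y≤y f c)
      ... | x , d , (f , f∈P , fc≤x) , d∈I , x≤d = f , d , f∈P , d∈I , A.trans fc≤x x≤d

      j≤⋁S : j ≤ ⋁ S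
      j≤⋁S = ≤-open λ {I} dI ⋁S≤o →
        let f , d , f∈P , d∈I , fa≤d = below-open dI (trans (⋁-upper S (inj₁ Eq.refl)) ⋁S≤o)
            g , e , g∈P , e∈I , gb≤e = below-open dI (trans (⋁-upper S (inj₂ Eq.refl)) ⋁S≤o)
            u , u∈I , d≤u , e≤u = proj₂ dI d∈I e∈I
            fg∧a∨b≤u = A.trans (distrib (f A.∧ g) a b) (A.∨-least
              (A.trans (∧-monotonic (A.x∧y≤x f g) A.refl) (A.trans fa≤d d≤u))
              (A.trans (∧-monotonic (A.x∧y≤y f g) A.refl) (A.trans gb≤e e≤u)))
        in trans (P-up fg∧a∨b≤u (P-∧ (P-∧ f∈P g∈P) j≤ιa∨b)) (⋁-Image-upper u∈I)

      j≈⋁S : j ≈ ⋁ S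
      j≈⋁S = antisym j≤⋁S (⋁-least S
        [ (λ x≈ → trans (reflexive x≈) (x∧y≤x _ _))
        , (λ x≈ → trans (reflexive x≈) (x∧y≤x _ _)) ]′)
    ... | x , inj₁ x≈ , j≈x = inj₁ (trans (reflexive (Eq.trans j≈x x≈)) (x∧y≤y _ _))
    ... | x , inj₂ x≈ , j≈x = inj₂ (trans (reflexive (Eq.trans j≈x x≈)) (x∧y≤y _ _))

-- Filter and ideal bases, and their images under `≺`.

module Directed {ℓ : Level} (𝕊 : SubordinationLattice ℓ) where
  open SubordinationLattice 𝕊
  open import Relation.Binary.Lattice.Properties.MeetSemilattice meetSemilattice
    using (∧-monotonic)
  open import Relation.Binary.Lattice.Properties.JoinSemilattice joinSemilattice
    using (∨-monotonic)

  -- Only bases: closure under ≤ is not required.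
  Filter Ideal : Pred Carrier ℓ → Set ℓ
  Filter = DownDirected lattice
  Ideal  = UpDirected lattice

  ↑ ↓ : Carrier → Pred Carrier ℓ
  ↑ a x = a ≤ x
  ↓ a x = x ≤ a

  -- `R j i` amounts to `≺[ P j ] ⊆ P i`, or dually to `≺⁻¹[ ∁ (P i) ] ⊆ ∁ (P j)`.
  ≺[_] ≺⁻¹[_] : Pred Carrier ℓ → Pred Carrier ℓ
  ≺[ F ] x   = ∃[ a ] (a ∈ F × a ≺ x)
  ≺⁻¹[ I ] x = ∃[ b ] (b ∈ I × x ≺ b)

  -- For directed arguments, the filter generated by `F ∪ G` and the ideal generated by `I ∪ J`.
  _⊓_ _⊔_ : Pred Carrier ℓ → Pred Carrier ℓ → Pred Carrier ℓ
  (F ⊓ G) x = ∃[ a ] ∃[ b ] (a ∈ F × b ∈ G × (a ∧ b) ≤ x)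
  (I ⊔ J) x = ∃[ a ] ∃[ b ] (a ∈ I × b ∈ J × x ≤ (a ∨ b))

  ↑-filter : ∀ a → Filter (↑ a)
  ↑-filter a = (a , refl) , λ a≤x a≤y → a , refl , a≤x , a≤y

  ↓-ideal : ∀ a → Ideal (↓ a)
  ↓-ideal a = (a , refl) , λ x≤a y≤a → a , refl , x≤a , y≤a

  ≺-filter : ∀ {F} → Filter F → Filter ≺[ F ]
  ≺-filter ((a , a∈F) , meet) =
    (⊤ , a , a∈F , ≤-≺-trans (maximum a) ⊤≺⊤) ,
    λ { {x} {y} (a , a∈F , a≺x) (b , b∈F , b≺y) →
      let c , c∈F , c≤a , c≤b = meet a∈F b∈F in
      x ∧ y , (c , c∈F , ≺-∧ (≤-≺-trans c≤a a≺x) (≤-≺-trans c≤b b≺y)) ,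
      x∧y≤x x y , x∧y≤y x y }

  ≺⁻¹-ideal : ∀ {I} → Ideal I → Ideal ≺⁻¹[ I ]
  ≺⁻¹-ideal ((a , a∈I) , join) =
    (⊥ , a , a∈I , ≺-≤-trans ⊥≺⊥ (minimum a)) ,
    λ { {x} {y} (a , a∈I , x≺a) (b , b∈I , y≺b) →
      let c , c∈I , a≤c , b≤c = join a∈I b∈I in
      x ∨ y , (c , c∈I , ≺-∨ (≺-≤-trans x≺a a≤c) (≺-≤-trans y≺b b≤c)) ,
      x≤x∨y x y , y≤x∨y x y }

  ⊓-filter : ∀ {F G} → Filter F → Filter G → Filter (F ⊓ G)
  ⊓-filter ((a , a∈F) , meetF) ((b , b∈G) , meetG) =
    (a ∧ b , a , b , a∈F , b∈G , refl) ,
    λ { (a , b , a∈F , b∈G , ab≤x) (c , d , c∈F , d∈G , cd≤y) →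
      let e , e∈F , e≤a , e≤c = meetF a∈F c∈F
          f , f∈G , f≤b , f≤d = meetG b∈G d∈G in
      e ∧ f , (e , f , e∈F , f∈G , refl) ,
      trans (∧-monotonic e≤a f≤b) ab≤x , trans (∧-monotonic e≤c f≤d) cd≤y }

  ⊔-ideal : ∀ {I J} → Ideal I → Ideal J → Ideal (I ⊔ J)
  ⊔-ideal ((a , a∈I) , joinI) ((b , b∈J) , joinJ) =
    (a ∨ b , a , b , a∈I , b∈J , refl) ,
    λ { (a , b , a∈I , b∈J , x≤ab) (c , d , c∈I , d∈J , y≤cd) →
      let e , e∈I , a≤e , c≤e = joinI a∈I c∈I
          f , f∈J , b≤f , d≤f = joinJ b∈J d∈J in
      e ∨ f , (e , f , e∈I , f∈J , refl) ,
      trans x≤ab (∨-monotonic a≤e b≤f) , trans y≤cd (∨-monotonic c≤e d≤f) }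

  ⊓-inˡ : ∀ {F G} → Filter G → F ⊆ F ⊓ G
  ⊓-inˡ ((b , b∈G) , _) a∈F = _ , b , a∈F , b∈G , x∧y≤x _ b

  ⊓-inʳ : ∀ {F G} → Filter F → G ⊆ F ⊓ G
  ⊓-inʳ ((a , a∈F) , _) b∈G = a , _ , a∈F , b∈G , x∧y≤y a _

  ⊔-inˡ : ∀ {I J} → Ideal J → I ⊆ I ⊔ J
  ⊔-inˡ ((b , b∈J) , _) a∈I = _ , b , a∈I , b∈J , x≤x∨y _ b

  ⊔-inʳ : ∀ {I J} → Ideal I → J ⊆ I ⊔ J
  ⊔-inʳ ((a , a∈I) , _) b∈J = a , _ , a∈I , b∈J , y≤x∨y a _

-- What the four equivalences use of the space of 𝕊.
record PrimeFilterSpace {ℓ : Level} (𝕊 : SubordinationLattice ℓ) : Set (suc (suc ℓ)) where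
  private
    module A = SubordinationLattice 𝕊
  open A using (_≺_; _∧_; _∨_)
  open Directed 𝕊

  infix 4 _⊑_
  field
    J        : Set (suc ℓ)
    _⊑_ R    : J → J → Set ℓ
    P        : J → Pred A.Carrier ℓ
    P-filter : ∀ j → Filter (P j)
    P-up     : ∀ j {a b} → a A.≤ b → a ∈ P j → b ∈ P j
    P-∧      : ∀ j {a b} → a ∈ P j → b ∈ P j → a ∧ b ∈ P j
    P-⊥      : ∀ j → A.⊥ ∉ P j
    P-∨      : ∀ j {a b} → a ∨ b ∈ P j → a ∈ P j ⊎ b ∈ P j
    ⊆⇒⊑      : ∀ {j k} → P j ⊆ P k → j ⊑ k
    ⊑⇒⊆      : ∀ {j k} → j ⊑ k → P j ⊆ P k
    R-intro  : ∀ {j i} → (∀ {a b} → a ∈ P j → a ≺ b → b ∈ P i) → R j i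
    R-elim   : ∀ {j i a b} → R j i → a ∈ P j → a ≺ b → b ∈ P i
    separation : ∀ {F I} → Filter F → Ideal I → (∀ {a b} → a ∈ F → b ∈ I → ¬ a A.≤ b) →
                 ∃[ j ] (F ⊆ P j × I ⊆ ∁ (P j))

-- The subordination space as a space of prime filters.

primeFilterSpace :
  {ℓ : Level} → ExcludedMiddle ℓ → ZornsLemma ℓ → (𝕊 : SubordinationLattice ℓ) →
  CanonicalExtension (BoundedLattice.lattice (SubordinationLattice.boundedLattice 𝕊)) →
  PrimeFilterSpace 𝕊
primeFilterSpace em zorn 𝕊 Aδ = record
  { J          = J∞
  ; _⊑_        = _⊑_
  ; R          = R
  ; P          = λ (j , _) → E.P j
  ; P-filter   = λ (_ , irr) → E.P-directed (J∞⇒Closed irr)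
  ; P-up       = λ _ → E.P-up
  ; P-∧        = λ _ → E.P-∧
  ; P-⊥        = λ (_ , irr) → E.irreducible-⊥ irr A.minimum
  ; P-∨        = λ (_ , irr) → E.irreducible-∨ irr λ x y z → A.reflexive (A.∧-distribˡ-∨ x y z)
  -- `j` is closed, hence the meet of `P j`; so a larger filter has a smaller element.
  ; ⊆⇒⊑        = λ {(_ , irr)} Pj⊆Pk →
      trans (E.⋀-Image-greatest Pj⊆Pk) (E.Closed⇒IsClosed (J∞⇒Closed irr))
  ; ⊑⇒⊆        = λ k≤j → trans k≤j
  -- `◇ j` is a meet of meets, over `a ∈ P j` and then over `b` with `a ≺ b`, so lying below it is
  -- checked on each `ι b`.
  ; R-intro    = λ h → ⋀-greatest _ λ { (a , a∈P , x≈◇a) →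
      trans (E.⋀-Image-greatest (h a∈P)) (reflexive (Eq.sym x≈◇a)) }
  ; R-elim     = λ jRi a∈P a≺b →
      trans jRi (trans (⋀-lower _ (_ , a∈P , Eq.refl)) (E.⋀-Image-lower a≺b))
  ; separation = E.separation zorn
  }
  where
  module A = SubordinationLattice 𝕊
  module E = CanonicalExtensionProperties em Aδ
  open SubordinationSpace 𝕊 Aδ
  open CanonicalExtension Aδ using (J∞⇒Closed; ⋀-lower; ⋀-greatest; trans; reflexive; module Eq)

module Correspondence
  {ℓ : Level} (em : ExcludedMiddle ℓ) {𝕊 : SubordinationLattice ℓ} (X : PrimeFilterSpace 𝕊)
  where
  private
    module A = SubordinationLattice 𝕊
  open A using (_≺_; _∧_; _∨_)
  open Directed 𝕊
  open Conditions 𝕊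
  open PrimeFilterSpace X

  private
    stable : {Y : Set ℓ} → ¬ ¬ Y → Y
    stable = decidable-stable em

  -- Existence of `R`-predecessors and `R`-successors.

  ∁P-ideal : ∀ j → Ideal (∁ (P j))
  ∁P-ideal j =
    (A.⊥ , P-⊥ j) ,
    λ {a} {b} a∉P b∉P →
      a ∨ b , (λ ab∈P → [ a∉P , b∉P ]′ (P-∨ j ab∈P)) , A.x≤x∨y a b , A.y≤x∨y a b

  -- A prime filter avoiding `≺⁻¹[ ∁ (P i) ]` is an `R`-predecessor of `i`; the hypothesis makes `F`
  -- disjoint from that ideal.
  predecessor : ∀ {F} i → Filter F → (∀ {a b} → a ∈ F → a ≺ b → b ∈ P i) →
                ∃[ j ] (F ⊆ P j × R j i)
  predecessor {F} i filter F≺P =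
    let j , F⊆P , I⊆∁P = separation filter (≺⁻¹-ideal (∁P-ideal i))
          λ { a∈F (c , c∉P , b≺c) a≤b → c∉P (F≺P a∈F (A.≤-≺-trans a≤b b≺c)) }
    in j , F⊆P , R-intro λ {a} {b} a∈P a≺b →
         stable λ b∉P → I⊆∁P (b , b∉P , a≺b) a∈P

  principal-predecessor : ∀ {a} i → ≺[ ↑ a ] ⊆ P i → ∃[ j ] (a ∈ P j × R j i)
  principal-predecessor i h =
    let j , ↑a⊆P , jRi = predecessor i (↑-filter _) λ a≤b b≺c → h (_ , a≤b , b≺c)
    in j , ↑a⊆P A.refl , jRi

  -- A prime filter containing `≺[ P j ]` is an `R`-successor of `j`; the hypothesis makes that
  -- filter disjoint from `I`.
  successor : ∀ {I} j → Ideal I → (∀ {a b} → a ∈ P j → b ∈ I → ¬ a ≺ b) →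
              ∃[ i ] (I ⊆ ∁ (P i) × R j i)
  successor j ideal P⊀I =
    let i , F⊆P , I⊆∁P = separation (≺-filter (P-filter j)) ideal
          λ { (a , a∈P , a≺x) b∈I x≤b → P⊀I a∈P b∈I (A.≺-≤-trans a≺x x≤b) }
    in i , I⊆∁P , R-intro λ a∈P a≺b → F⊆P (_ , a∈P , a≺b)

  principal-successor : ∀ {b} j → b ∉ ≺[ P j ] → ∃[ i ] (b ∉ P i × R j i)
  principal-successor j b∉ =
    let i , ↓b⊆∁P , jRi = successor j (↓-ideal _)
          λ a∈P x≤b a≺x → b∉ (_ , a∈P , A.≺-≤-trans a≺x x≤b)
    in i , ↓b⊆∁P A.refl , jRi

  -- The four correspondences.

  Interpolating Commuting JoinSplitting MeetSplitting : Set (suc ℓ)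
  Interpolating = ∀ (i j : J) → R j i → ∃[ k ] (j ⊑ k × R j k × R k i)
  Commuting = ∀ (i j k : J) → (R k i × R k j) ⇔ (∃[ k′ ] (k′ ⊑ i × R k′ j × R k k′))
  JoinSplitting = ∀ (i j k i′ : J) → R i′ i × R i′ j × R k i′ →
    ∃[ j′ ] (j′ ⊑ i × j′ ⊑ j × R k j′)
  MeetSplitting = ∀ (i j k i′ : J) → R i′ k × R i i′ × R j i′ →
    ∃[ j′ ] (R j′ k × i ⊑ j′ × j ⊑ j′)

  -- `P k` has to contain both `P j` and `≺[ P j ]`; (CT) ensures that the filter they generate is
  -- still sent into `P i` by `≺`.
  CT⇒space : CT → Interpolating
  CT⇒space ct i j jRi =
    let k , F⊆P , kRi = predecessor i (⊓-filter (P-filter j) dG)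
          λ { {x} {c} (a , b , a∈P , (a′ , a′∈P , a′≺b) , ab≤x) x≺c →
            R-elim jRi (P-∧ j a∈P a′∈P)
              -- Meeting `a` with `a′` gives one element of `P j` that is `≺ b` and whose meet with
              -- `b` is below `x`.
              (ct (a ∧ a′) b c (A.≤-≺-trans (A.x∧y≤y a a′) a′≺b)
                (A.≤-≺-trans
                  (A.trans (A.∧-greatest (A.trans (A.x∧y≤x _ b) (A.x∧y≤x a a′)) (A.x∧y≤y _ b)) ab≤x)
                  x≺c)) }
    in k , ⊆⇒⊑ (λ a∈P → F⊆P (⊓-inˡ dG a∈P)) ,
       R-intro (λ a∈P a≺b → F⊆P (⊓-inʳ (P-filter j) (_ , a∈P , a≺b))) , kRi
    where
    dG : Filter ≺[ P j ]
    dG = ≺-filter (P-filter j)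

  -- If `a ⊀ c`, some `R j i` has `a ∈ P j` and `c ∉ P i`. The interpolant `k` contains `a` and `b`,
  -- so `a ∧ b ≺ c` forces `c ∈ P i`.
  space⇒CT : Interpolating → CT
  space⇒CT space a b c a≺b ab≺c = stable λ a⊀c →
    let i , F⊆Pi , ↓c⊆∁Pi = separation (≺-filter (↑-filter a)) (↓-ideal c)
          λ { (a′ , a≤a′ , a′≺x) y≤c x≤y →
            a⊀c (A.≤-≺-trans a≤a′ (A.≺-≤-trans a′≺x (A.trans x≤y y≤c))) }
        j , a∈Pj , jRi = principal-predecessor i F⊆Pi
        k , j⊑k , jRk , kRi = space i j jRi
    in ↓c⊆∁Pi A.refl
         (R-elim kRi (P-∧ k (⊑⇒⊆ j⊑k a∈Pj) (R-elim jRk a∈Pj a≺b)) ab≺c)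

  S9⇒space : S9 → Commuting
  S9⇒space s9 i j k = mk⇔ to from
    where
    -- Avoiding `∁ (P i)` yields `k′ ⊑ i`, and avoiding `≺⁻¹[ ∁ (P j) ]` yields `R k′ j`. An
    -- obstruction is turned by (S9) into a join in `P k`, contradicting primeness.
    to : R k i × R k j → ∃[ k′ ] (k′ ⊑ i × R k′ j × R k k′)
    to (kRi , kRj) =
      let k′ , I⊆∁P , kRk′ = successor k (⊔-ideal (∁P-ideal i) dJ)
            λ { {x} {y} x∈P (a , c , a∉P , (d , d∉P , c≺d) , y≤ac) x≺y →
              let a′ , d′ , a′≺a , d′≺d , x≤a′d′ =
                    s9 a d x .Equivalence.to (c , c≺d , A.≺-≤-trans x≺y y≤ac)
              in [ (λ a′∈P → a∉P (R-elim kRi a′∈P a′≺a))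
                 , (λ d′∈P → d∉P (R-elim kRj d′∈P d′≺d))
                 ]′ (P-∨ k (P-up k x≤a′d′ x∈P)) }
      in k′ ,
         ⊆⇒⊑ (λ a∈P → stable λ a∉P → I⊆∁P (⊔-inˡ dJ a∉P) a∈P) ,
         R-intro (λ a∈P a≺b → stable λ b∉P →
           I⊆∁P (⊔-inʳ (∁P-ideal i) (_ , b∉P , a≺b)) a∈P) ,
         kRk′
      where
      dJ : Ideal ≺⁻¹[ ∁ (P j) ]
      dJ = ≺⁻¹-ideal (∁P-ideal j)

    -- S9 with a = a′ = ⊥ makes ≺ interpolative.
    from : ∃[ k′ ] (k′ ⊑ i × R k′ j × R k k′) → R k i × R k j
    from (k′ , k′⊑i , k′Rj , kRk′) =
      R-intro (λ a∈P a≺b → ⊑⇒⊆ k′⊑i (R-elim kRk′ a∈P a≺b)) ,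
      R-intro λ {p} {b} p∈P p≺b →
        let c , c≺b , p≺⊥∨c =
              s9 A.⊥ b p .Equivalence.from (A.⊥ , p , A.⊥≺⊥ , p≺b , A.y≤x∨y A.⊥ p)
        in R-elim k′Rj
             (R-elim kRk′ p∈P (A.≺-≤-trans p≺⊥∨c (A.∨-least (A.minimum c) A.refl))) c≺b

  space⇒S9 : Commuting → S9
  space⇒S9 space a b x = mk⇔ to from
    where
    -- Otherwise some `P k` contains `x` but nothing `≺ a` or `≺ b`, so `k` has successors omitting
    -- `a` and `b`. Then `P k′` contains `a ∨ c` but neither `a` nor `c`.
    to : ∃[ c ] (c ≺ b × x ≺ (a ∨ c)) → ∃[ a′ ] ∃[ b′ ] (a′ ≺ a × b′ ≺ b × x A.≤ (a′ ∨ b′))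
    to (c , c≺b , x≺ac) = stable λ none →
      let k , ↑x⊆P , I⊆∁P = separation (↑-filter x)
            (⊔-ideal (≺⁻¹-ideal (↓-ideal a)) (≺⁻¹-ideal (↓-ideal b)))
            λ { x≤y (a′ , b′ , (u , u≤a , a′≺u) , (v , v≤b , b′≺v) , z≤a′b′) y≤z →
              none (a′ , b′ , A.≺-≤-trans a′≺u u≤a , A.≺-≤-trans b′≺v v≤b ,
                    A.trans x≤y (A.trans y≤z z≤a′b′)) }
          i , a∉P , kRi = principal-successor k λ { (_ , a′∈P , a′≺a) →
            I⊆∁P (⊔-inˡ (≺⁻¹-ideal (↓-ideal b)) (a , A.refl , a′≺a)) a′∈P }
          j , b∉P , kRj = principal-successor k λ { (_ , b′∈P , b′≺b) →
            I⊆∁P (⊔-inʳ (≺⁻¹-ideal (↓-ideal a)) (b , A.refl , b′≺b)) b′∈P }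
          k′ , k′⊑i , k′Rj , kRk′ = space i j k .Equivalence.to (kRi , kRj)
      in [ (λ a∈P → a∉P (⊑⇒⊆ k′⊑i a∈P)) , (λ c∈P → b∉P (R-elim k′Rj c∈P c≺b)) ]′
           (P-∨ k′ (R-elim kRk′ (↑x⊆P A.refl) x≺ac))

    -- Otherwise some `P k′` contains `≺[ ↑ x ]` but neither `a` nor anything `≺ b`, and a
    -- predecessor `k` contains `x`, hence `a′` or `b′`.
    from : ∃[ a′ ] ∃[ b′ ] (a′ ≺ a × b′ ≺ b × x A.≤ (a′ ∨ b′)) → ∃[ c ] (c ≺ b × x ≺ (a ∨ c))
    from (a′ , b′ , a′≺a , b′≺b , x≤a′b′) = stable λ none →
      let dJ = ≺⁻¹-ideal (↓-ideal b)
          k′ , F⊆P , I⊆∁P = separation (≺-filter (↑-filter x)) (⊔-ideal (↓-ideal a) dJ)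
            λ { (p , x≤p , p≺y) (u , c , u≤a , (v , v≤b , c≺v) , z≤uc) y≤z →
              none (c , A.≺-≤-trans c≺v v≤b ,
                    A.≤-≺-trans x≤p (A.≺-≤-trans p≺y (A.trans y≤z (A.trans z≤uc
                      (A.∨-least (A.trans u≤a (A.x≤x∨y a c)) (A.y≤x∨y a c)))))) }
          k , x∈P , kRk′ = principal-predecessor k′ F⊆P
          j , b∉P , k′Rj = principal-successor k′ λ { (_ , c∈P , c≺b) →
            I⊆∁P (⊔-inʳ (↓-ideal a) (b , A.refl , c≺b)) c∈P }
          -- With `k′` itself in the role of `i`, the condition reduces to transitivity of `R`.
          _ , kRj = space k′ j k .Equivalence.from
            (k′ , ⊆⇒⊑ (λ p → p) , k′Rj , kRk′)
      in [ (λ a′∈P → I⊆∁P (⊔-inˡ dJ A.refl) (R-elim kRk′ a′∈P a′≺a))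
         , (λ b′∈P → b∉P (R-elim kRj b′∈P b′≺b))
         ]′ (P-∨ k (P-up k x≤a′b′ x∈P))

  -- `P j′` has to avoid both complements. An obstruction `p ≺ b ∨ c` splits by (SL1) into a join in
  -- `P i′`, whose primeness puts `b` in `P i` or `c` in `P j`.
  SL1⇒space : SL1 → JoinSplitting
  SL1⇒space sl1 i j k i′ (i′Ri , i′Rj , kRi′) =
    let j′ , I⊆∁P , kRj′ = successor k (⊔-ideal (∁P-ideal i) (∁P-ideal j))
          λ { {p} {y} p∈P (b , c , b∉P , c∉P , y≤bc) p≺y →
            let b′ , c′ , b′≺b , c′≺c , p≺b′c′ = sl1 p b c (A.≺-≤-trans p≺y y≤bc)
            in [ (λ b′∈P → b∉P (R-elim i′Ri b′∈P b′≺b))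
               , (λ c′∈P → c∉P (R-elim i′Rj c′∈P c′≺c))
               ]′ (P-∨ i′ (R-elim kRi′ p∈P p≺b′c′)) }
    in j′ ,
       ⊆⇒⊑ (λ a∈P → stable λ a∉P → I⊆∁P (⊔-inˡ (∁P-ideal j) a∉P) a∈P) ,
       ⊆⇒⊑ (λ a∈P → stable λ a∉P → I⊆∁P (⊔-inʳ (∁P-ideal i) a∉P) a∈P) ,
       kRj′

  -- Without a splitting, some `P i′` contains `≺[ ↑ a ]` but nothing `≺ b` or `≺ c`. Its neighbours
  -- `k`, `i`, `j` then yield a `P j′` containing `b ∨ c` but neither part.
  space⇒SL1 : JoinSplitting → SL1
  space⇒SL1 space a b c a≺bc = stable λ none →
    let dI = ≺⁻¹-ideal (↓-ideal b)
        dJ = ≺⁻¹-ideal (↓-ideal c)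
        i′ , F⊆P , I⊆∁P = separation (≺-filter (↑-filter a)) (⊔-ideal dI dJ)
          λ { (p , a≤p , p≺y) (b′ , c′ , (u , u≤b , b′≺u) , (v , v≤c , c′≺v) , z≤b′c′) y≤z →
            none (b′ , c′ , A.≺-≤-trans b′≺u u≤b , A.≺-≤-trans c′≺v v≤c ,
                  A.≤-≺-trans a≤p (A.≺-≤-trans p≺y (A.trans y≤z z≤b′c′))) }
        i , b∉P , i′Ri = principal-successor i′ λ { (_ , b′∈P , b′≺b) →
          I⊆∁P (⊔-inˡ dJ (b , A.refl , b′≺b)) b′∈P }
        j , c∉P , i′Rj = principal-successor i′ λ { (_ , c′∈P , c′≺c) →
          I⊆∁P (⊔-inʳ dI (c , A.refl , c′≺c)) c′∈P }
        k , a∈P , kRi′ = principal-predecessor i′ F⊆P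
        j′ , j′⊑i , j′⊑j , kRj′ = space i j k i′ (i′Ri , i′Rj , kRi′)
    in [ (λ b∈P → b∉P (⊑⇒⊆ j′⊑i b∈P)) , (λ c∈P → c∉P (⊑⇒⊆ j′⊑j c∈P)) ]′
         (P-∨ j′ (R-elim kRj′ a∈P a≺bc))

  -- `P j′` extends the filter generated by `P i` and `P j`; (SL2) routes each `b ∧ c ≺ d` through a
  -- meet lying in `P i′`.
  SL2⇒space : SL2 → MeetSplitting
  SL2⇒space sl2 i j k i′ (i′Rk , iRi′ , jRi′) =
    let j′ , F⊆P , j′Rk = predecessor k (⊓-filter (P-filter i) (P-filter j))
          λ { {y} {d} (b , c , b∈P , c∈P , bc≤y) y≺d →
            let b′ , c′ , b≺b′ , c≺c′ , b′c′≺d = sl2 d b c (A.≤-≺-trans bc≤y y≺d)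
            in R-elim i′Rk (P-∧ i′ (R-elim iRi′ b∈P b≺b′) (R-elim jRi′ c∈P c≺c′)) b′c′≺d }
    in j′ , j′Rk ,
       ⊆⇒⊑ (λ a∈P → F⊆P (⊓-inˡ (P-filter j) a∈P)) ,
       ⊆⇒⊑ (λ a∈P → F⊆P (⊓-inʳ (P-filter i) a∈P))

  -- Without a splitting, some `P i′` contains `≺[ ↑ b ]` and `≺[ ↑ c ]` but nothing `≺ a`. Then
  -- `P j′` contains `b ∧ c`, although its successor `k` omits `a`.
  space⇒SL2 : MeetSplitting → SL2
  space⇒SL2 space a b c bc≺a = stable λ none →
    let dF = ≺-filter (↑-filter b)
        dG = ≺-filter (↑-filter c)
        i′ , F⊆P , I⊆∁P = separation (⊓-filter dF dG) (≺⁻¹-ideal (↓-ideal a))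
          λ { (b′ , c′ , (u , b≤u , u≺b′) , (v , c≤v , v≺c′) , b′c′≤y) (w , w≤a , z≺w) y≤z →
            none (b′ , c′ , A.≤-≺-trans b≤u u≺b′ , A.≤-≺-trans c≤v v≺c′ ,
                  A.≤-≺-trans (A.trans b′c′≤y y≤z) (A.≺-≤-trans z≺w w≤a)) }
        k , a∉P , i′Rk = principal-successor i′ λ { (_ , d∈P , d≺a) →
          I⊆∁P (a , A.refl , d≺a) d∈P }
        i , b∈P , iRi′ = principal-predecessor i′ λ b≺ → F⊆P (⊓-inˡ dG b≺)
        j , c∈P , jRi′ = principal-predecessor i′ λ c≺ → F⊆P (⊓-inʳ dF c≺)
        j′ , j′Rk , i⊑j′ , j⊑j′ = space i j k i′ (i′Rk , iRi′ , jRi′)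
    in a∉P (R-elim j′Rk
              (P-∧ j′ (⊑⇒⊆ i⊑j′ b∈P) (⊑⇒⊆ j⊑j′ c∈P)) bc≺a)

proposition6p12 :
    {ℓ : Level} → ExcludedMiddle ℓ → ZornsLemma ℓ →
    (𝕊 : SubordinationLattice ℓ) →
    (Aδ : CanonicalExtension (BoundedLattice.lattice (SubordinationLattice.boundedLattice 𝕊))) →
    let open Conditions 𝕊
        open SubordinationSpace 𝕊 Aδ
    in
      (CT ⇔ (∀ (i j : J∞) → R j i → ∃[ k ] (j ⊑ k × R j k × R k i)))
      × (S9 ⇔ (∀ (i j k : J∞) → (R k i × R k j) ⇔ (∃[ k′ ] (k′ ⊑ i × R k′ j × R k k′))))
      × (SL1 ⇔ (∀ (i j k i′ : J∞) → R i′ i × R i′ j × R k i′ → ∃[ j′ ] (j′ ⊑ i × j′ ⊑ j × R k j′)))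
      × (SL2 ⇔ (∀ (i j k i′ : J∞) → R i′ k × R i i′ × R j i′ → ∃[ j′ ] (R j′ k × i ⊑ j′ × j ⊑ j′)))
proposition6p12 em zorn 𝕊 Aδ =
  mk⇔ CT⇒space space⇒CT , mk⇔ S9⇒space space⇒S9 ,
  mk⇔ SL1⇒space space⇒SL1 , mk⇔ SL2⇒space space⇒SL2
  where open Correspondence em (primeFilterSpace em zorn 𝕊 Aδ)
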